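{- Let $\Sigma$ be a finite alphabet and $w,w'\in\Sigma^*$. Then $w$ and $w'$ are strongly $M$-equivalent if and only if for every $v\in\Sigma^*$ such that $|v|_a\le 1$ for all $a\in\Sigma$, we have $|w|_v=|w'|_v$.
   Context: For words $w,u\in\Sigma^*$, $|w|_u$ is the number of occurrences of $u$ as a scattered subword of $w$ (two occurrences are different iff they differ in at least one position of some letter); $|w|_\lambda=1$ for the empty word $\lambda$. Parikh matrices: for an ordered alphabet $\Gamma=\{a_1<a_2<\dots<a_s\}$, the Parikh matrix mapping $\Psi_\Gamma:\Gamma^*\to\mathcal M_{s+1}$ is the monoid morphism into the multiplicative monoid of $(s+1)\times(s+1)$ upper triangular matrices with nonnegative integer entries and unit diagonal that sends $a_q$ to the matrix with $1$'s on the diagonal, $1$ in position $(q,q+1)$, and $0$ elsewhere. Two words are $M$-equivalent with respect to $\Gamma$ iff they have the same image under $\Psi_\Gamma$. Strong $M$-equivalence: for an (unordered) alphabet $\Sigma$, words $w,w'\in\Sigma^*$ are strongly $M$-equivalent iff they are $M$-equivalent with respect to every ordered alphabet whose underlying set is $\Sigma$. -}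

module Defs where

open import Level using (Level) renaming (suc to lsuc)
open import Algebra.Definitions.RawMonoid using (sum)
open import Data.Bool.Base using (if_then_else_; _∧_; _∨_)
open import Data.Fin.Base using (Fin; suc; inject₁)
open import Data.Fin.Properties using (inj⇒≟) renaming (_≟_ to _≟ᶠ_)
open import Data.List.Base using (List; []; _∷_; _++_; map; filter; foldr; length)
open import Data.List.Properties using (≡-dec)
open import Data.Nat.Base using (ℕ; suc; _*_; +-0-rawMonoid)
open import Data.Vec.Functional using (Vector)
open import Function.Bundles using (_↔_; module Inverse)
open import Function.Properties.Inverse using (↔⇒↣; ↔-sym)
open import Relation.Binary.Definitions using (DecidableEquality)
open import Relation.Binary.PropositionalEquality.Core using (_≡_)
open import Relation.Nullary.Decidable using (⌊_⌋)

private
  variable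
    a : Level
    A : Set a
    n s : ℕ

Matrix : ℕ → Set
Matrix n = Vector (Vector ℕ n) n

infix 4 _≈ᴹ_
infixl 7 _*ᴹ_

_≈ᴹ_ : Matrix n → Matrix n → Set
M ≈ᴹ N = ∀ i j → M i j ≡ N i j

1ᴹ : Matrix n
1ᴹ i j = if ⌊ i ≟ᶠ j ⌋ then 1 else 0

_*ᴹ_ : Matrix n → Matrix n → Matrix n
(M *ᴹ N) i j = sum +-0-rawMonoid (λ k → M i k * N k j)

-- With rows and columns counted from 0 the off-diagonal 1 is at (q , q + 1).
letterMatrix : Fin s → Matrix (suc s)
letterMatrix q i j =
  if ⌊ i ≟ᶠ j ⌋ ∨ (⌊ i ≟ᶠ inject₁ q ⌋ ∧ ⌊ j ≟ᶠ suc q ⌋) then 1 else 0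

-- An ordered alphabet {a₁ < … < aₛ} with underlying set A is the increasing
-- enumeration of its letters; every bijection arises from exactly one order.
OrderedAlphabet : Set a → ℕ → Set a
OrderedAlphabet A s = Fin s ↔ A

-- The codomain is the monoid of all (s+1)×(s+1) matrices over ℕ; the image
-- lies in the submonoid of upper triangular matrices with unit diagonal.
parikh : OrderedAlphabet A s → List A → Matrix (suc s)
parikh Γ = foldr (λ x M → letterMatrix (Inverse.from Γ x) *ᴹ M) 1ᴹ

MEquivalent : OrderedAlphabet A s → List A → List A → Set
MEquivalent Γ w w′ = parikh Γ w ≈ᴹ parikh Γ w′

StronglyMEquivalent : {A : Set a} → List A → List A → Set a
StronglyMEquivalent {A = A} w w′ =
  ∀ {s} (Γ : OrderedAlphabet A s) → MEquivalent Γ w w′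

-- One entry for each set of positions of the word, so that equal subwords at
-- different positions are listed separately.
scatteredSubwords : List A → List (List A)
scatteredSubwords []      = [] ∷ []
scatteredSubwords (x ∷ w) = map (x ∷_) (scatteredSubwords w) ++ scatteredSubwords w

record FiniteAlphabet a : Set (lsuc a) where
  field
    Letter      : Set a
    size        : ℕ
    enumeration : Fin size ↔ Letter

  Word : Set a
  Word = List Letter

  _≟_ : DecidableEquality Letter
  _≟_ = inj⇒≟ (↔⇒↣ (↔-sym enumeration))

  ∣_∣[_] : Word → Word → ℕ
  ∣ w ∣[ u ] = length (filter (≡-dec _≟_ u) (scatteredSubwords w))

{-# OPTIONS --safe #-}
-- For i ≤ j the (i , j) entry of the Parikh matrix of w over a₁ < … < aₛ is
-- |w|_v for the factor v of a₁ ⋯ aₛ between the positions i and j, and the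
-- entries below the diagonal vanish.  Such a factor repeats no letter.
-- Conversely, a word without repeated letters is a prefix of a₁ ⋯ aₛ for a
-- suitable order: append the missing letters to it.
module Submission where

open import Defs
open import Algebra.Definitions.RawMonoid using (sum)
open import Data.Fin.Base using (Fin; zero; suc; inject₁; toℕ; _<_)
open import Data.Fin.Properties as Fin using (inject₁-injective; toℕ-inject₁)
  renaming (_≟_ to _≟ᶠ_)
open import Data.List.Base
  using (List; []; _∷_; [_]; _++_; map; filter; length; lookup; tabulate)
open import Data.List.Membership.Propositional using (_∈_)
open import Data.List.Membership.Propositional.Properties
  using (∈-++⁺ˡ; ∈-++⁺ʳ; ∈-filter⁺; ∈-filter⁻; ∈-lookup; ∈-tabulate⁺)
open import Data.List.Properties
  using (≡-dec; ∷-injectiveˡ; ∷-injectiveʳ; filter-++; filter-none; length-++)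
open import Data.List.Relation.Unary.All as All using (All; []; _∷_)
open import Data.List.Relation.Unary.All.Properties as All using (¬Any⇒All¬)
open import Data.List.Relation.Unary.AllPairs using ([]; _∷_)
open import Data.List.Relation.Unary.Any using (here; there; any?; index)
open import Data.List.Relation.Unary.Any.Properties using (lookup-index)
open import Data.List.Relation.Unary.Unique.Propositional using (Unique)
open import Data.List.Relation.Unary.Unique.Propositional.Properties
  using (tabulate⁺; filter⁺; ++⁺)
open import Data.Nat.Base using (ℕ; zero; suc; _+_; _*_; _≤_; z≤n; s≤s; +-0-rawMonoid)
open import Data.Nat.Properties as ℕ
  using (≤-trans; ≤-refl; ≤-reflexive; <-≤-trans; <⇒≤; n≤1+n; m≤n+m; <-irrefl)
open import Data.Product.Base using (∃; _×_; _,_; proj₂)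
open import Data.Sum.Base using (_⊎_; inj₁; inj₂)
open import Function.Base using (_∘_)
open import Function.Bundles using (_⇔_; mk⇔; _↔_; mk↔ₛ′; module Inverse; Injection)
open import Function.Definitions using (Injective)
open import Function.Properties.Inverse using (↔⇒↣)
open import Level using (Level)
open import Relation.Binary.PropositionalEquality
  using (_≡_; _≢_; refl; sym; trans; cong; cong₂; subst; module ≡-Reasoning)
open import Relation.Nullary using (¬_; yes; no; contradiction)
open import Relation.Nullary.Decidable using (¬?; toSum)
open import Relation.Unary using (Pred; Decidable)

private
  variable
    a p q : Level
    A B : Set a
    n s : ℕ

-- Filtered lists, and lists as enumerations of a type.

length-filter-map : {P : Pred A p} {Q : Pred B q} (P? : Decidable P) (Q? : Decidable Q)
  {f : A → B} → (∀ {x} → P x → Q (f x)) → (∀ {x} → Q (f x) → P x) →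
  ∀ xs → length (filter Q? (map f xs)) ≡ length (filter P? xs)
length-filter-map P? Q? to from [] = refl
length-filter-map P? Q? {f} to from (x ∷ xs) with P? x | Q? (f x)
... | yes _  | yes _  = cong suc (length-filter-map P? Q? to from xs)
... | yes px | no ¬qx = contradiction (to px) ¬qx
... | no ¬px | yes qx = contradiction (from qx) ¬px
... | no _   | no _   = length-filter-map P? Q? to from xs

lookup-injective : {xs : List A} → Unique xs → Injective _≡_ _≡_ (lookup xs)
lookup-injective (_ ∷ _)    {zero}  {zero}  _  = refl
lookup-injective {xs = _ ∷ xs} (x∉ ∷ _) {zero} {suc j} eq =
  contradiction eq (All.lookup x∉ (∈-lookup {xs = xs} j))
lookup-injective {xs = _ ∷ xs} (x∉ ∷ _) {suc i} {zero} eq =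
  contradiction (sym eq) (All.lookup x∉ (∈-lookup {xs = xs} i))
lookup-injective (_ ∷ uniq) {suc i} {suc j} eq = cong suc (lookup-injective uniq eq)

-- Makes a list into an ordered alphabet: letters are ordered by position, and `Unique` makes the
-- position named by a membership proof the only one.
lookup-↔ : {xs : List A} → Unique xs → (∀ x → x ∈ xs) → Fin (length xs) ↔ A
lookup-↔ {xs = xs} uniq complete = mk↔ₛ′ (lookup xs) (index ∘ complete)
  (λ x → sym (lookup-index (complete x)))
  (λ i → lookup-injective uniq (sym (lookup-index (complete (lookup xs i)))))

-- Finite sums and products with letter matrices.

Σ[_] : (Fin n → ℕ) → ℕ
Σ[_] = sum +-0-rawMonoid

sum-zero : (f : Fin n → ℕ) → (∀ k → f k ≡ 0) → Σ[ f ] ≡ 0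
sum-zero {zero}  f f≡0 = refl
sum-zero {suc n} f f≡0 = cong₂ _+_ (f≡0 zero) (sum-zero (f ∘ suc) (f≡0 ∘ suc))

sum-singleton : (f : Fin n → ℕ) (i : Fin n) → (∀ k → k ≢ i → f k ≡ 0) → Σ[ f ] ≡ f i
sum-singleton f zero f≡0 = trans
  (cong (f zero +_) (sum-zero (f ∘ suc) (λ k → f≡0 (suc k) λ ())))
  (ℕ.+-identityʳ (f zero))
sum-singleton f (suc i) f≡0 = cong₂ _+_ (f≡0 zero λ ())
  (sum-singleton (f ∘ suc) i (λ k k≢i → f≡0 (suc k) (k≢i ∘ Fin.suc-injective)))

-- Meant for row `inject₁ q` of `letterMatrix q`, its only row with two nonzero entries.
sum-adjacent : (f : Fin (suc n) → ℕ) (q : Fin n) →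
  (∀ k → k ≢ inject₁ q → k ≢ suc q → f k ≡ 0) → Σ[ f ] ≡ f (inject₁ q) + f (suc q)
sum-adjacent f zero f≡0 = cong (f zero +_)
  (sum-singleton (f ∘ suc) zero (λ k k≢0 → f≡0 (suc k) (λ ()) (k≢0 ∘ Fin.suc-injective)))
sum-adjacent f (suc q) f≡0 = cong₂ _+_ (f≡0 zero (λ ()) λ ())
  (sum-adjacent (f ∘ suc) q (λ k k≢ k≢′ →
    f≡0 (suc k) (k≢ ∘ Fin.suc-injective) (k≢′ ∘ Fin.suc-injective)))

1ᴹ-diagonal : (i : Fin n) → 1ᴹ i i ≡ 1
1ᴹ-diagonal i with i ≟ᶠ i
... | yes _  = refl
... | no i≢i = contradiction refl i≢i

1ᴹ-off-diagonal : {i j : Fin n} → i ≢ j → 1ᴹ i j ≡ 0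
1ᴹ-off-diagonal {i = i} {j} i≢j with i ≟ᶠ j
... | yes i≡j = contradiction i≡j i≢j
... | no _    = refl

letterMatrix-diagonal : (q : Fin s) (i : Fin (suc s)) → letterMatrix q i i ≡ 1
letterMatrix-diagonal q i with i ≟ᶠ i
... | yes _  = refl
... | no i≢i = contradiction refl i≢i

letterMatrix-superdiagonal : (q : Fin s) → letterMatrix q (inject₁ q) (suc q) ≡ 1
letterMatrix-superdiagonal q
  with inject₁ q ≟ᶠ suc q | inject₁ q ≟ᶠ inject₁ q | suc q ≟ᶠ suc q
... | yes _ | _     | _     = refl
... | no _  | yes _ | yes _ = refl
... | no _  | no ≢  | _     = contradiction refl ≢
... | no _  | yes _ | no ≢  = contradiction refl ≢

letterMatrix-off : {q : Fin s} {i j : Fin (suc s)} → j ≢ i →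
  ¬ (i ≡ inject₁ q × j ≡ suc q) → letterMatrix q i j ≡ 0
letterMatrix-off {q = q} {i} {j} j≢i off
  with i ≟ᶠ j | i ≟ᶠ inject₁ q | j ≟ᶠ suc q
... | yes i≡j | _      | _      = contradiction (sym i≡j) j≢i
... | no _    | yes eq | yes eq′ = contradiction (eq , eq′) off
... | no _    | yes _  | no _   = refl
... | no _    | no _   | _      = refl

-- Left multiplication by a letter matrix is an elementary row operation. The added row comes first
-- in the sum to line up with `count-∷-same`.
letterMatrix-*ᴹ-row : (q : Fin s) (M : Matrix (suc s)) (j : Fin (suc s)) →
  (letterMatrix q *ᴹ M) (inject₁ q) j ≡ M (suc q) j + M (inject₁ q) j
letterMatrix-*ᴹ-row q M j = begin
  (letterMatrix q *ᴹ M) (inject₁ q) j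
    ≡⟨ sum-adjacent _ q (λ k k≢ k≢′ → cong (_* M k j)
         (letterMatrix-off k≢ (k≢′ ∘ proj₂))) ⟩
  letterMatrix q (inject₁ q) (inject₁ q) * M (inject₁ q) j
    + letterMatrix q (inject₁ q) (suc q) * M (suc q) j
    ≡⟨ cong₂ (λ x y → x * M (inject₁ q) j + y * M (suc q) j)
         (letterMatrix-diagonal q (inject₁ q)) (letterMatrix-superdiagonal q) ⟩
  1 * M (inject₁ q) j + 1 * M (suc q) j
    ≡⟨ cong₂ _+_ (ℕ.*-identityˡ (M (inject₁ q) j)) (ℕ.*-identityˡ (M (suc q) j)) ⟩
  M (inject₁ q) j + M (suc q) j
    ≡⟨ ℕ.+-comm (M (inject₁ q) j) _ ⟩
  M (suc q) j + M (inject₁ q) j ∎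
  where open ≡-Reasoning

letterMatrix-*ᴹ-other-row : (q : Fin s) (M : Matrix (suc s)) {i j : Fin (suc s)} →
  i ≢ inject₁ q → (letterMatrix q *ᴹ M) i j ≡ M i j
letterMatrix-*ᴹ-other-row q M {i} {j} i≢q = begin
  (letterMatrix q *ᴹ M) i j
    ≡⟨ sum-singleton _ i (λ k k≢i → cong (_* M k j)
         (letterMatrix-off k≢i λ (i≡q , _) → i≢q i≡q)) ⟩
  letterMatrix q i i * M i j  ≡⟨ cong (_* M i j) (letterMatrix-diagonal q i) ⟩
  1 * M i j                   ≡⟨ ℕ.*-identityˡ _ ⟩
  M i j                       ∎
  where open ≡-Reasoning

-- Factors of an enumeration.

-- Factor f i v j: v is the word f i ⋯ f (j - 1).
data Factor {a} {A : Set a} {s} (f : Fin s → A) : Fin (suc s) → List A → Fin (suc s) → Set a where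
  empty : ∀ {i} → Factor f i [] i
  next  : ∀ {q v j} → Factor f (suc q) v j → Factor f (inject₁ q) (f q ∷ v) j

-- `inject₁ (suc q)` reduces to `suc (inject₁ q)`, so each constructor carries over as it stands.
factor-suc : {f : Fin (suc s) → A} {i j : Fin (suc s)} {v : List A} →
  Factor (f ∘ suc) i v j → Factor f (suc i) v (suc j)
factor-suc empty    = empty
factor-suc (next φ) = next (factor-suc φ)

factor-≤ : {f : Fin s → A} {i j : Fin (suc s)} {v : List A} → Factor f i v j → toℕ i ≤ toℕ j
factor-≤ empty            = ≤-refl
factor-≤ (next {q = q} φ) = ≤-trans (≤-reflexive (toℕ-inject₁ q)) (<⇒≤ (factor-≤ φ))

factor-⊆ : {P : Pred A p} {f : Fin s → A} {i j : Fin (suc s)} {v : List A} →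
  (∀ k → P (f k)) → Factor f i v j → All P v
factor-⊆ Pf empty            = []
factor-⊆ Pf (next {q = q} φ) = Pf q ∷ factor-⊆ Pf φ

-- The witness `j` is the length of `v`.
factor-prefix : (v r : List A) → ∃ λ j → Factor (lookup (v ++ r)) zero v j
factor-prefix []      r = zero , empty
factor-prefix (x ∷ v) r with j , φ ← factor-prefix v r = suc j , next {q = zero} (factor-suc φ)

-- Induction on both positions: lowering both by one drops the first letter, replacing `f` by
-- `f ∘ suc`.
unique-factor : {f : Fin s → A} → Injective _≡_ _≡_ f → (i j : Fin (suc s)) →
  j < i ⊎ ∃ λ v → Factor f i v j × Unique v
unique-factor f-inj zero zero = inj₂ ([] , empty , [])
unique-factor f-inj (suc i) zero = inj₁ (s≤s z≤n)
unique-factor {s = suc s} f-inj zero (suc j)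
  with unique-factor (Fin.suc-injective ∘ f-inj) zero j
-- The alternative `inj₁` would assert `j < zero`. The new head `f zero` is not in `v`, whose
-- letters are all of the form `f (suc k)`.
... | inj₂ (v , φ , uniq) = inj₂ (_ , next {q = zero} (factor-suc φ) ,
  factor-⊆ (λ k f0≡fk → contradiction (f-inj f0≡fk) λ ()) φ ∷ uniq)
unique-factor {s = suc s} f-inj (suc i) (suc j)
  with unique-factor (Fin.suc-injective ∘ f-inj) i j
... | inj₁ j<i            = inj₁ (s≤s j<i)
... | inj₂ (v , φ , uniq) = inj₂ (v , factor-suc φ , uniq)

-- Row recursion for Parikh matrices.

module _ (Γ : OrderedAlphabet A s) where
  open Inverse Γ using (to; from; strictlyInverseˡ)

  -- The row is a separate `q` with an equation because for `x = to q` the index `from x` equals `q`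
  -- only propositionally.
  parikh-row : ∀ {q x} w j → from x ≡ q →
    parikh Γ (x ∷ w) (inject₁ q) j ≡ parikh Γ w (suc q) j + parikh Γ w (inject₁ q) j
  parikh-row w j refl = letterMatrix-*ᴹ-row _ (parikh Γ w) j

  parikh-other-row : ∀ {x i j} w → i ≢ inject₁ (from x) →
    parikh Γ (x ∷ w) i j ≡ parikh Γ w i j
  parikh-other-row w = letterMatrix-*ᴹ-other-row _ (parikh Γ w)

  -- toSum keeps the with-abstraction from rewriting the same decision where it
  -- occurs inside the unfolded matrix entries.
  parikh-lower : ∀ w {i j} → j < i → parikh Γ w i j ≡ 0
  parikh-lower []      j<i = 1ᴹ-off-diagonal λ { refl → <-irrefl refl j<i }
  parikh-lower (x ∷ w) {i} {j} j<i with toSum (i ≟ᶠ inject₁ (from x))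
  ... | inj₂ i≢    = trans (parikh-other-row w i≢) (parikh-lower w j<i)
  ... | inj₁ refl = trans (parikh-row w j refl)
    (cong₂ _+_ (parikh-lower w (<-≤-trans j<i inject₁≤suc)) (parikh-lower w j<i))
    where
    inject₁≤suc : toℕ (inject₁ (from x)) ≤ suc (toℕ (from x))
    inject₁≤suc = ≤-trans (≤-reflexive (toℕ-inject₁ (from x))) (n≤1+n _)

-- Recursion for subword counts.

module _ (𝒜 : FiniteAlphabet a) where
  open FiniteAlphabet 𝒜

  -- `scatteredSubwords (x ∷ w)` lists the position sets containing the leading position before
  -- those avoiding it.
  count-∷ : ∀ x w u → ∣ x ∷ w ∣[ u ] ≡
    length (filter (≡-dec _≟_ u) (map (x ∷_) (scatteredSubwords w))) + ∣ w ∣[ u ]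
  count-∷ x w u = trans
    (cong length (filter-++ (≡-dec _≟_ u) (map (x ∷_) (scatteredSubwords w)) _))
    (length-++ (filter (≡-dec _≟_ u) (map (x ∷_) (scatteredSubwords w))))

  count-∷-other : ∀ {x u} w → (∀ v → u ≢ x ∷ v) → ∣ x ∷ w ∣[ u ] ≡ ∣ w ∣[ u ]
  count-∷-other {x} {u} w u≢ = trans (count-∷ x w u)
    (cong (λ ws → length ws + ∣ w ∣[ u ])
      (filter-none (≡-dec _≟_ u) (All.map⁺ (All.universal u≢ (scatteredSubwords w)))))

  -- An occurrence of `x ∷ u` either uses the leading letter and continues with an occurrence of `u`
  -- in `w`, or lies within `w`.
  count-∷-same : ∀ x w u → ∣ x ∷ w ∣[ x ∷ u ] ≡ ∣ w ∣[ u ] + ∣ w ∣[ x ∷ u ]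
  count-∷-same x w u = trans (count-∷ x w (x ∷ u))
    (cong (_+ ∣ w ∣[ x ∷ u ])
      (length-filter-map (≡-dec _≟_ u) (≡-dec _≟_ (x ∷ u))
        (cong (x ∷_)) ∷-injectiveʳ (scatteredSubwords w)))

  count-empty : ∀ w → ∣ w ∣[ [] ] ≡ 1
  count-empty []      = refl
  count-empty (x ∷ w) = trans (count-∷-other w λ _ ()) (count-empty w)

  count-letter-here : ∀ x w → ∣ x ∷ w ∣[ [ x ] ] ≡ suc ∣ w ∣[ [ x ] ]
  count-letter-here x w =
    trans (count-∷-same x w []) (cong (_+ ∣ w ∣[ [ x ] ]) (count-empty w))

  count-letter-there : ∀ {x y} w → y ≢ x → ∣ x ∷ w ∣[ [ y ] ] ≡ ∣ w ∣[ [ y ] ]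
  count-letter-there w y≢x = count-∷-other w λ v → y≢x ∘ ∷-injectiveˡ

  count-letter-∉ : ∀ {y w} → All (y ≢_) w → ∣ w ∣[ [ y ] ] ≡ 0
  count-letter-∉ []                   = refl
  count-letter-∉ {w = _ ∷ w} (y≢x ∷ y∉w) =
    trans (count-letter-there w y≢x) (count-letter-∉ y∉w)

  count-letter-mono : ∀ x w y → ∣ w ∣[ [ y ] ] ≤ ∣ x ∷ w ∣[ [ y ] ]
  count-letter-mono x w y =
    ≤-trans (m≤n+m _ _) (≤-reflexive (sym (count-∷ x w [ y ])))

  count-letter-∈ : ∀ {y w} → y ∈ w → 1 ≤ ∣ w ∣[ [ y ] ]
  count-letter-∈ {w = x ∷ w} (here refl) =
    ≤-trans (s≤s z≤n) (≤-reflexive (sym (count-letter-here x w)))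
  count-letter-∈ {y} {x ∷ w} (there y∈w) =
    ≤-trans (count-letter-∈ y∈w) (count-letter-mono x w y)

  unique⇒count-letter≤1 : ∀ {v} → Unique v → ∀ y → ∣ v ∣[ [ y ] ] ≤ 1
  unique⇒count-letter≤1 []                     y = z≤n
  unique⇒count-letter≤1 {x ∷ v} (x∉v ∷ uniq) y with toSum (y ≟ x)
  ... | inj₁ refl = ≤-reflexive
    (trans (count-letter-here x v) (cong suc (count-letter-∉ x∉v)))
  ... | inj₂ y≢x   = ≤-trans (≤-reflexive (count-letter-there v y≢x))
    (unique⇒count-letter≤1 uniq y)

  -- A further `x` in `v` would raise the count of `x` in `x ∷ v` to at least 2. The bound passes to
  -- `v` since prepending a letter never lowers a count.
  count-letter≤1⇒unique : ∀ v → (∀ y → ∣ v ∣[ [ y ] ] ≤ 1) → Unique v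
  count-letter≤1⇒unique []      _  = []
  count-letter≤1⇒unique (x ∷ v) ≤1 =
    ¬Any⇒All¬ v (λ x∈v → <-irrefl refl (≤-trans (s≤s (count-letter-∈ x∈v))
      (≤-trans (≤-reflexive (sym (count-letter-here x v))) (≤1 x))))
    ∷ count-letter≤1⇒unique v (λ y → ≤-trans (count-letter-mono x v y) (≤1 y))

  -- Induction on `w`. If the prepended `x` is the first letter of `v`, its row operation and the
  -- count obey the same recursion; otherwise entry and count both stay unchanged.
  parikh-factor : (Γ : OrderedAlphabet Letter s) → ∀ w {i v j} →
    Factor (Inverse.to Γ) i v j → parikh Γ w i j ≡ ∣ w ∣[ v ]
  parikh-factor Γ []      {i} empty = 1ᴹ-diagonal i
  -- The count is 0 by computation; the entry is off the diagonal, since a nonempty factor ends at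
  -- `suc q` or later.
  parikh-factor Γ []      {j = j} (next {q = q} φ) = 1ᴹ-off-diagonal λ { refl →
    <-irrefl refl (≤-trans (factor-≤ φ) (≤-reflexive (toℕ-inject₁ q))) }
  parikh-factor Γ (x ∷ w) {i} empty with toSum (i ≟ᶠ inject₁ (Inverse.from Γ x))
  ... | inj₂ i≢    = trans (parikh-other-row Γ w i≢)
    (trans (parikh-factor Γ w empty) (sym (count-∷-other w λ _ ())))
  -- Here `x` does act on row `i`, but the entry it adds, in row `suc (from x)` and column `i`, lies
  -- below the diagonal.
  ... | inj₁ refl = trans (parikh-row Γ w i refl)
    (trans (cong₂ _+_
             (parikh-lower Γ w (s≤s (≤-reflexive (toℕ-inject₁ _))))
             (parikh-factor Γ w empty))
           (sym (count-∷-other w λ _ ())))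
  parikh-factor Γ (x ∷ w) {j = j} (next {q = q} {v} φ) with toSum (x ≟ Inverse.to Γ q)
  ... | inj₁ refl = trans (parikh-row Γ w j (Inverse.strictlyInverseʳ Γ q))
    (trans (cong₂ _+_ (parikh-factor Γ w φ) (parikh-factor Γ w (next φ)))
           (sym (count-∷-same x w v)))
  -- If `x` acted on row `inject₁ q`, then `from x` would be `q` and `x` would be `to q`.
  ... | inj₂ x≢    = trans (parikh-other-row Γ w λ eq → x≢ (trans
        (sym (Inverse.strictlyInverseˡ Γ x))
        (cong (Inverse.to Γ) (sym (inject₁-injective eq)))))
    (trans (parikh-factor Γ w (next φ))
           (sym (count-∷-other w λ _ → x≢ ∘ sym ∘ ∷-injectiveˡ)))

  -- Completing a word to an ordered alphabet, and the equivalence.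

  missing : Word → Word
  missing v = filter (λ x → ¬? (any? (x ≟_) v)) (tabulate (Inverse.to enumeration))

  unique-completion : ∀ {v} → Unique v → Unique (v ++ missing v)
  unique-completion {v} uniq = ++⁺ uniq
    (filter⁺ _ (tabulate⁺ (Injection.injective (↔⇒↣ enumeration))))
    λ (x∈v , x∈missing) → proj₂ (∈-filter⁻ (λ x → ¬? (any? (x ≟_) v))
      {xs = tabulate (Inverse.to enumeration)} x∈missing) x∈v

  ∈-completion : ∀ v x → x ∈ v ++ missing v
  ∈-completion v x with any? (x ≟_) v
  ... | yes x∈v = ∈-++⁺ˡ x∈v
  ... | no x∉v  = ∈-++⁺ʳ v (∈-filter⁺ (λ x → ¬? (any? (x ≟_) v))
    (subst (_∈ tabulate (Inverse.to enumeration)) (Inverse.strictlyInverseˡ enumeration x)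
      (∈-tabulate⁺ (Inverse.from enumeration x))) x∉v)

theorem3p3 : ∀ {a} (𝒜 : FiniteAlphabet a) → let open FiniteAlphabet 𝒜 in
    (w w′ : Word) →
    StronglyMEquivalent w w′ ⇔
    (∀ (v : Word) → (∀ (x : Letter) → ∣ v ∣[ [ x ] ] ≤ 1) → ∣ w ∣[ v ] ≡ ∣ w′ ∣[ v ])
theorem3p3 𝒜 w w′ = mk⇔ equal-counts equal-matrices
  where
  open FiniteAlphabet 𝒜

  equal-counts : StronglyMEquivalent w w′ →
    ∀ v → (∀ x → ∣ v ∣[ [ x ] ] ≤ 1) → ∣ w ∣[ v ] ≡ ∣ w′ ∣[ v ]
  -- With `v` as a prefix of the order, its count is an entry of the top row.
  equal-counts w~w′ v ≤1 with j , φ ← factor-prefix v (missing 𝒜 v) = trans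
    (sym (parikh-factor 𝒜 Γ w φ)) (trans (w~w′ Γ zero j) (parikh-factor 𝒜 Γ w′ φ))
    where
    -- The index is this length instead of `size`, which the quantification over all `s` in
    -- `StronglyMEquivalent` permits.
    Γ : OrderedAlphabet Letter (length (v ++ missing 𝒜 v))
    Γ = lookup-↔ (unique-completion 𝒜 (count-letter≤1⇒unique 𝒜 v ≤1)) (∈-completion 𝒜 v)

  equal-matrices : (∀ v → (∀ x → ∣ v ∣[ [ x ] ] ≤ 1) → ∣ w ∣[ v ] ≡ ∣ w′ ∣[ v ]) →
    StronglyMEquivalent w w′
  equal-matrices counts Γ i j with unique-factor (Injection.injective (↔⇒↣ Γ)) i j
  ... | inj₁ j<i            = trans (parikh-lower Γ w j<i) (sym (parikh-lower Γ w′ j<i))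
  ... | inj₂ (v , φ , uniq) = trans (parikh-factor 𝒜 Γ w φ)
    (trans (counts v (unique⇒count-letter≤1 𝒜 uniq)) (sym (parikh-factor 𝒜 Γ w′ φ)))
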